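{- Let $(P_k)_{k \ge 1}$ be the Pell number sequence $0, 1, 2, 5, 12, 29, 70, 169, 408, 985, 2378, \dots$, indexed so that $P_1 = 0$, $P_2 = 1$ and $P_{k+2} = 2P_{k+1} + P_k$ for all $k \ge 1$. Then for every integer $n \ge 0$, $$(P_{2n+3}+1)^5 + (P_{2n+3}-1)^5 = \bigl(P_{2n+3} + i (P_{2n+3}+P_{2n+2})\bigr)^5 + \bigl(P_{2n+3} - i (P_{2n+3}+P_{2n+2})\bigr)^5 .$$ This gives an infinite sequence of solutions of $w^5 + x^5 = y^5 + z^5$ with $w, x$ positive integers and $y, z$ Gaussian integers. The cases $n = 0,1,2,3,4$ are $$3^5 + 1^5 = (2 + 3i)^5 + (2 - 3i)^5,$$ $$13^5 + 11^5 = (12 + 17i)^5 + (12 - 17i)^5,$$ $$71^5 + 69^5 = (70 + 99i)^5 + (70 - 99i)^5,$$ $$409^5 + 407^5 = (408 + 577i)^5 + (408 - 577i)^5,$$ $$2379^5 + 2377^5 = (2378 + 3363i)^5 + (2378 - 3363i)^5 .$$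
   Context: Here $i$ denotes the imaginary unit, and a Gaussian integer is a complex number $p + iq$ with $p, q \in \mathbb{Z}$. Note the indexing of the Pell numbers: the first term is $P_1 = 0$, so that $P_3 = 2$, $P_4 = 5$, $P_5 = 12$, and so on. -}

module Defs where

open import Algebra.Bundles.Raw using (RawRing)
import Algebra.Definitions.RawSemiring as RawSemiringDefinitions
open import Data.Integer as ℤ using (ℤ; +_; 0ℤ; 1ℤ)
open import Data.List using (List; []; _∷_; map; upTo)
open import Data.Nat as ℕ using (ℕ; suc; NonZero)
open import Data.Product using (_×_; _,_)
open import Level using (0ℓ)
open import Relation.Binary.PropositionalEquality using (_≡_; refl)

-- The sequence starts at index 1, so index 0 is excluded by the type.
P : (k : ℕ) → .{{NonZero k}} → ℤ
P 1                   = 0ℤ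
P 2                   = 1ℤ
P (suc (suc (suc k))) = + 2 ℤ.* P (suc (suc k)) ℤ.+ P (suc k)

P-initial : map (λ k → P (suc k)) (upTo 11) ≡
            map +_ (0 ∷ 1 ∷ 2 ∷ 5 ∷ 12 ∷ 29 ∷ 70 ∷ 169 ∷ 408 ∷ 985 ∷ 2378 ∷ [])
P-initial = refl

-- gauss p q stands for the complex number p + iq.
record ℤ[i] : Set where
  constructor gauss
  field
    re im : ℤ

open ℤ[i] public

ι : ℤ → ℤ[i]
ι p = gauss p 0ℤ

i : ℤ[i]
i = gauss 0ℤ 1ℤ

infix  8 -_
infixl 7 _*_
infixl 6 _+_ _-_

_+_ : ℤ[i] → ℤ[i] → ℤ[i]
gauss a b + gauss c d = gauss (a ℤ.+ c) (b ℤ.+ d)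

_*_ : ℤ[i] → ℤ[i] → ℤ[i]
gauss a b * gauss c d = gauss (a ℤ.* c ℤ.- b ℤ.* d) (a ℤ.* d ℤ.+ b ℤ.* c)

-_ : ℤ[i] → ℤ[i]
- gauss a b = gauss (ℤ.- a) (ℤ.- b)

_-_ : ℤ[i] → ℤ[i] → ℤ[i]
x - y = x + (- y)

ℤ[i]-rawRing : RawRing 0ℓ 0ℓ
ℤ[i]-rawRing = record
  { Carrier = ℤ[i]
  ; _≈_     = _≡_
  ; _+_     = _+_
  ; _*_     = _*_
  ; -_      = -_
  ; 0#      = ι 0ℤ
  ; 1#      = ι 1ℤ
  }

open RawSemiringDefinitions (RawRing.rawSemiring ℤ[i]-rawRing) public using (_^_)

Quadruple : Set
Quadruple = ℤ × ℤ × ℤ[i] × ℤ[i]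

IsSolution : Quadruple → Set
IsSolution (w , x , y , z) =
  0ℤ ℤ.< w × 0ℤ ℤ.< x × ι w ^ 5 + ι x ^ 5 ≡ y ^ 5 + z ^ 5

-- The indices are written 3 + 2n and 2 + 2n, rather than 2n + 3 and 2n + 2, so
-- that they reduce to successors and are seen to be nonzero.
pellQuadruple : ℕ → Quadruple
pellQuadruple n = a ℤ.+ 1ℤ , a ℤ.- 1ℤ , ι a + i * ι (a ℤ.+ b) , ι a - i * ι (a ℤ.+ b)
  where
  a b : ℤ
  a = P (3 ℕ.+ 2 ℕ.* n)
  b = P (2 ℕ.+ 2 ℕ.* n)

{-# OPTIONS --safe #-}
-- Put q = is with s = a + b.  In any commutative ring
--   (a+q)⁵ + (a−q)⁵ = (a+1)⁵ + (a−1)⁵ + 10a(q²−1)(q²+2a²+1),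
-- and the last factor vanishes when s² = 2a² + 1.  Consecutive Pell numbers
-- b, a satisfy this equation for every other index, because
-- (b , a) ↦ (2a+b , 5a+2b), the step by two indices, preserves (a+b)² − 2a².
module Submission where

open import Defs
open import Algebra.Bundles using (CommutativeRing)
open import Algebra.Consequences.Propositional {A = ℤ[i]} using (comm∧idˡ⇒id; comm∧distrˡ⇒distrʳ)
import Algebra.Solver.Ring.AlmostCommutativeRing as ACR
import Algebra.Solver.Ring.Simple as RingSolver
open import Data.Integer as ℤ using (ℤ; +_; 0ℤ; 1ℤ)
import Data.Integer.Properties as ℤ
open import Data.Integer.Tactic.RingSolver using (solve-∀)
open import Data.Nat as ℕ using (ℕ; zero; suc; s≤s; z≤n)
import Data.Nat.Properties as ℕ
open import Data.Product using (_×_; _,_; proj₁; proj₂)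
open import Function.Base using (_∘_)
open import Function.Definitions using (Injective)
open import Level using (0ℓ)
open import Relation.Binary.Definitions using (DecidableEquality; tri<; tri≈; tri>)
open import Relation.Binary.PropositionalEquality
  using (_≡_; refl; sym; trans; cong; cong₂; subst; isEquivalence; module ≡-Reasoning)
open import Algebra.Definitions (_≡_ {A = ℤ[i]})
  using (Associative; Commutative; LeftIdentity; _DistributesOverˡ_)
open import Algebra.Properties.AbelianGroup ℤ.+-0-abelianGroup using (∙-cancelʳ)
open import Algebra.Structures (_≡_ {A = ℤ[i]}) using (IsCommutativeRing)
open import Relation.Nullary.Decidable using (map′; _×-dec_)
open import Relation.Nullary.Negation using (contradiction)

*-comm : Commutative _*_
*-comm (gauss a b) (gauss c d) = cong₂ gauss (real a b c d) (imaginary a b c d)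
  where
  real : ∀ a b c d → a ℤ.* c ℤ.- b ℤ.* d ≡ c ℤ.* a ℤ.- d ℤ.* b
  real = solve-∀
  imaginary : ∀ a b c d → a ℤ.* d ℤ.+ b ℤ.* c ≡ c ℤ.* b ℤ.+ d ℤ.* a
  imaginary = solve-∀

*-assoc : Associative _*_
*-assoc (gauss a b) (gauss c d) (gauss e f) = cong₂ gauss (real a b c d e f) (imaginary a b c d e f)
  where
  real : ∀ a b c d e f →
    (a ℤ.* c ℤ.- b ℤ.* d) ℤ.* e ℤ.- (a ℤ.* d ℤ.+ b ℤ.* c) ℤ.* f ≡
    a ℤ.* (c ℤ.* e ℤ.- d ℤ.* f) ℤ.- b ℤ.* (c ℤ.* f ℤ.+ d ℤ.* e)
  real = solve-∀
  imaginary : ∀ a b c d e f →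
    (a ℤ.* c ℤ.- b ℤ.* d) ℤ.* f ℤ.+ (a ℤ.* d ℤ.+ b ℤ.* c) ℤ.* e ≡
    a ℤ.* (c ℤ.* f ℤ.+ d ℤ.* e) ℤ.+ b ℤ.* (c ℤ.* e ℤ.- d ℤ.* f)
  imaginary = solve-∀

*-identityˡ : LeftIdentity (ι 1ℤ) _*_
*-identityˡ (gauss a b) = cong₂ gauss
  (trans (ℤ.+-identityʳ (1ℤ ℤ.* a)) (ℤ.*-identityˡ a))
  (trans (ℤ.+-identityʳ (1ℤ ℤ.* b)) (ℤ.*-identityˡ b))

*-distribˡ-+ : _*_ DistributesOverˡ _+_
*-distribˡ-+ (gauss a b) (gauss c d) (gauss e f) = cong₂ gauss (real a b c d e f) (imaginary a b c d e f)
  where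
  real : ∀ a b c d e f →
    a ℤ.* (c ℤ.+ e) ℤ.- b ℤ.* (d ℤ.+ f) ≡ (a ℤ.* c ℤ.- b ℤ.* d) ℤ.+ (a ℤ.* e ℤ.- b ℤ.* f)
  real = solve-∀
  imaginary : ∀ a b c d e f →
    a ℤ.* (d ℤ.+ f) ℤ.+ b ℤ.* (c ℤ.+ e) ≡ (a ℤ.* d ℤ.+ b ℤ.* c) ℤ.+ (a ℤ.* f ℤ.+ b ℤ.* e)
  imaginary = solve-∀

isCommutativeRing : IsCommutativeRing _+_ _*_ (λ x → - x) (ι 0ℤ) (ι 1ℤ)
isCommutativeRing = record
  { isRing = record
    { +-isAbelianGroup = record
      { isGroup = record
        { isMonoid = record
          { isSemigroup = record
            { isMagma = record { isEquivalence = isEquivalence ; ∙-cong = cong₂ _+_ }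
            ; assoc   = λ (gauss a b) (gauss c d) (gauss e f) →
                cong₂ gauss (ℤ.+-assoc a c e) (ℤ.+-assoc b d f)
            }
          ; identity =
              (λ (gauss a b) → cong₂ gauss (ℤ.+-identityˡ a) (ℤ.+-identityˡ b)) ,
              (λ (gauss a b) → cong₂ gauss (ℤ.+-identityʳ a) (ℤ.+-identityʳ b))
          }
        ; inverse =
            (λ (gauss a b) → cong₂ gauss (ℤ.+-inverseˡ a) (ℤ.+-inverseˡ b)) ,
            (λ (gauss a b) → cong₂ gauss (ℤ.+-inverseʳ a) (ℤ.+-inverseʳ b))
        ; ⁻¹-cong = cong (λ x → - x)
        }
      ; comm = λ (gauss a b) (gauss c d) → cong₂ gauss (ℤ.+-comm a c) (ℤ.+-comm b d)
      }
    ; *-cong     = cong₂ _*_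
    ; *-assoc    = *-assoc
    ; *-identity = comm∧idˡ⇒id *-comm *-identityˡ
    ; distrib    = *-distribˡ-+ , comm∧distrˡ⇒distrʳ *-comm *-distribˡ-+
    }
  ; *-comm = *-comm
  }

commutativeRing : CommutativeRing 0ℓ 0ℓ
commutativeRing = record { isCommutativeRing = isCommutativeRing }

open CommutativeRing commutativeRing using (zeroʳ; +-identityʳ)

-- The solver takes its coefficients from the ring itself, so that `i` can occur as a constant;
-- normalising such coefficients requires deciding their equality.
_≟_ : DecidableEquality ℤ[i]
gauss a b ≟ gauss c d =
  map′ (λ (p , q) → cong₂ gauss p q) (λ p → cong re p , cong im p) (a ℤ.≟ c ×-dec b ℤ.≟ d)

open RingSolver (ACR.fromCommutativeRing commutativeRing) _≟_
  using (solve; con; _:+_; _:*_; _:-_; _:^_; _:=_)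

-- Odd powers of q cancel, which leaves 2a⁵ + 20a³t + 10at² with t = q². Subtracting the value at t
-- = 1 gives 20a³(t - 1) + 10a(t² - 1), from which 10a(t - 1) splits off.
fifth-powers : ∀ a q → (a + q) ^ 5 + (a - q) ^ 5 ≡
  (a + ι 1ℤ) ^ 5 + (a - ι 1ℤ) ^ 5
    + ι (+ 10) * a * (q * q - ι 1ℤ) * (q * q + ι (+ 2) * (a * a) + ι 1ℤ)
fifth-powers = solve 2 (λ a q → (a :+ q) :^ 5 :+ (a :- q) :^ 5 :=
  (a :+ con (ι 1ℤ)) :^ 5 :+ (a :- con (ι 1ℤ)) :^ 5
    :+ con (ι (+ 10)) :* a :* (q :* q :- con (ι 1ℤ))
      :* (q :* q :+ con (ι (+ 2)) :* (a :* a) :+ con (ι 1ℤ))) refl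

fifth-powers-coincide : ∀ a q → q * q + ι (+ 2) * (a * a) + ι 1ℤ ≡ ι 0ℤ →
  (a + ι 1ℤ) ^ 5 + (a - ι 1ℤ) ^ 5 ≡ (a + q) ^ 5 + (a - q) ^ 5
fifth-powers-coincide a q vanishes = sym (begin
  (a + q) ^ 5 + (a - q) ^ 5  ≡⟨ fifth-powers a q ⟩
  S + c * _                  ≡⟨ cong (λ t → S + c * t) vanishes ⟩
  S + c * ι 0ℤ               ≡⟨ cong (λ t → S + t) (zeroʳ c) ⟩
  S + ι 0ℤ                   ≡⟨ +-identityʳ S ⟩
  S                          ∎)
  where
  open ≡-Reasoning
  S c : ℤ[i]
  S = (a + ι 1ℤ) ^ 5 + (a - ι 1ℤ) ^ 5
  c = ι (+ 10) * a * (q * q - ι 1ℤ)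

-- Unlike for sums and negatives, evaluation alone is not enough here: `x ℤ.* 0ℤ` is stuck for a
-- variable `x`.
ι-* : ∀ x y → ι x * ι y ≡ ι (x ℤ.* y)
ι-* x y = cong₂ gauss (ℤ.+-identityʳ (x ℤ.* y)) (trans (ℤ.+-identityʳ (x ℤ.* 0ℤ)) (ℤ.*-zeroʳ x))

PellEquation : ℤ → ℤ → Set
PellEquation s a = s ℤ.* s ≡ + 2 ℤ.* (a ℤ.* a) ℤ.+ 1ℤ

PellEquation⇒vanishing : ∀ s a → PellEquation s a →
  (i * ι s) * (i * ι s) + ι (+ 2) * (ι a * ι a) + ι 1ℤ ≡ ι 0ℤ
PellEquation⇒vanishing s a pell = begin
  (i * ι s) * (i * ι s) + ι (+ 2) * (ι a * ι a) + ι 1ℤ  ≡⟨ i²≡-1 (ι s) (ι a) ⟩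
  ι (+ 2) * (ι a * ι a) + ι 1ℤ - ι s * ι s
    ≡⟨ cong₂ (λ x y → ι (+ 2) * x + ι 1ℤ - y) (ι-* a a) (ι-* s s) ⟩
  ι (+ 2) * ι (a ℤ.* a) + ι 1ℤ - ι (s ℤ.* s)
    ≡⟨ cong (λ x → x + ι 1ℤ - ι (s ℤ.* s)) (ι-* (+ 2) (a ℤ.* a)) ⟩
  ι (+ 2 ℤ.* (a ℤ.* a) ℤ.+ 1ℤ ℤ.- s ℤ.* s)              ≡⟨ cong ι (ℤ.i≡j⇒i-j≡0 (sym pell)) ⟩
  ι 0ℤ                                                  ∎
  where
  open ≡-Reasoning
  i²≡-1 : ∀ x y →
    (i * x) * (i * x) + ι (+ 2) * (y * y) + ι 1ℤ ≡ ι (+ 2) * (y * y) + ι 1ℤ - x * x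
  -- Since `i` enters as a coefficient, normalisation evaluates `i * i` to -1.
  i²≡-1 = solve 2 (λ x y →
    (con i :* x) :* (con i :* x) :+ con (ι (+ 2)) :* (y :* y) :+ con (ι 1ℤ) :=
    con (ι (+ 2)) :* (y :* y) :+ con (ι 1ℤ) :- x :* x) refl

pellEquation-fifth-powers : ∀ s a → PellEquation s a →
  (ι a + ι 1ℤ) ^ 5 + (ι a - ι 1ℤ) ^ 5 ≡ (ι a + i * ι s) ^ 5 + (ι a - i * ι s) ^ 5
pellEquation-fifth-powers s a = fifth-powers-coincide (ι a) (i * ι s) ∘ PellEquation⇒vanishing s a

-- With s = a + b, the step multiplies s + a√2 by 3 + 2√2 = (1 + √2)², a unit of norm 1. A single
-- Pell step multiplies by 1 + √2, of norm -1, which is why indices advance by two.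
pellEquation-step : ∀ a b → let b′ = + 2 ℤ.* a ℤ.+ b; a′ = + 2 ℤ.* b′ ℤ.+ a in
  PellEquation (a ℤ.+ b) a → PellEquation (a′ ℤ.+ b′) a′
pellEquation-step a b pell = begin
  s′ ℤ.* s′                                             ≡⟨ invariant a b ⟩
  d ℤ.+ s ℤ.* s ℤ.- + 2 ℤ.* (a ℤ.* a)                   ≡⟨ cong (λ t → d ℤ.+ t ℤ.- + 2 ℤ.* (a ℤ.* a)) pell ⟩
  d ℤ.+ (+ 2 ℤ.* (a ℤ.* a) ℤ.+ 1ℤ) ℤ.- + 2 ℤ.* (a ℤ.* a) ≡⟨ cancel d (+ 2 ℤ.* (a ℤ.* a)) ⟩
  d ℤ.+ 1ℤ                                              ∎
  where
  open ≡-Reasoning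
  b′ a′ s s′ d : ℤ
  b′ = + 2 ℤ.* a ℤ.+ b
  a′ = + 2 ℤ.* b′ ℤ.+ a
  s = a ℤ.+ b
  s′ = a′ ℤ.+ b′
  d = + 2 ℤ.* (a′ ℤ.* a′)
  invariant : ∀ a b → let b′ = + 2 ℤ.* a ℤ.+ b; a′ = + 2 ℤ.* b′ ℤ.+ a in
    (a′ ℤ.+ b′) ℤ.* (a′ ℤ.+ b′) ≡
    + 2 ℤ.* (a′ ℤ.* a′) ℤ.+ (a ℤ.+ b) ℤ.* (a ℤ.+ b) ℤ.- + 2 ℤ.* (a ℤ.* a)
  invariant = solve-∀
  cancel : ∀ x y → x ℤ.+ (y ℤ.+ 1ℤ) ℤ.- y ≡ x ℤ.+ 1ℤ
  cancel = solve-∀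

P-pellEquation : ∀ n → let a = P (3 ℕ.+ 2 ℕ.* n); b = P (2 ℕ.+ 2 ℕ.* n) in
  PellEquation (a ℤ.+ b) a
-- Here a = 2 and b = 1, so the equation reads 9 = 2·4 + 1.
P-pellEquation zero    = refl
P-pellEquation (suc n) =
  -- `2 ℕ.* suc n` does not reduce to `2 ℕ.+ 2 ℕ.* n`; once it is rewritten, the recurrence unfolds
  -- to exactly the two terms of the step.
  subst (λ k → PellEquation (P (3 ℕ.+ k) ℤ.+ P (2 ℕ.+ k)) (P (3 ℕ.+ k))) (sym (ℕ.*-suc 2 n))
    (pellEquation-step (P (3 ℕ.+ 2 ℕ.* n)) (P (2 ℕ.+ 2 ℕ.* n)) (P-pellEquation n))

-- The two claims need a joint induction: 0 ≤ x < y gives y > 0, hence y < 2y ≤ 2y + x. The bound on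
-- x is weak because the sequence starts at 0.
P-nonNegative-increasing : ∀ k → 0ℤ ℤ.≤ P (suc k) × P (suc k) ℤ.< P (2 ℕ.+ k)
P-nonNegative-increasing zero    = ℤ.+≤+ z≤n , ℤ.+<+ (s≤s z≤n)
P-nonNegative-increasing (suc k) with P-nonNegative-increasing k
... | 0≤x , x<y = ℤ.<⇒≤ 0<y , (begin-strict
  y                  ≡⟨ ℤ.+-identityʳ y ⟨
  y ℤ.+ 0ℤ           <⟨ ℤ.+-monoʳ-< y 0<y ⟩
  y ℤ.+ y            ≡⟨ ℤ.+-identityʳ (y ℤ.+ y) ⟨
  y ℤ.+ y ℤ.+ 0ℤ     ≤⟨ ℤ.+-monoʳ-≤ (y ℤ.+ y) 0≤x ⟩
  y ℤ.+ y ℤ.+ x      ≡⟨ cong (ℤ._+ x) (double y) ⟩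
  + 2 ℤ.* y ℤ.+ x    ∎)
  where
  open ℤ.≤-Reasoning
  x y : ℤ
  x = P (suc k)
  y = P (2 ℕ.+ k)
  0<y : 0ℤ ℤ.< y
  0<y = ℤ.≤-<-trans 0≤x x<y
  double : ∀ y → y ℤ.+ y ≡ + 2 ℤ.* y
  double = solve-∀

P-mono-< : ∀ {j k} → j ℕ.< k → P (suc j) ℤ.< P (suc k)
-- The order `ℕ.<′` raises the upper index by one at a time, so consecutive comparisons chain
-- together.
P-mono-< = go ∘ ℕ.<⇒<′
  where
  go : ∀ {j k} → j ℕ.<′ k → P (suc j) ℤ.< P (suc k)
  go {j} ℕ.<′-base       = proj₂ (P-nonNegative-increasing j)
  go {k = suc k} (ℕ.<′-step j<k) = ℤ.<-trans (go j<k) (proj₂ (P-nonNegative-increasing k))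

P-injective : ∀ {j k} → P (suc j) ≡ P (suc k) → j ≡ k
P-injective {j} {k} eq with ℕ.<-cmp j k
... | tri< j<k _ _ = contradiction (P-mono-< j<k) (ℤ.<-irrefl eq)
... | tri≈ _ j≡k _ = j≡k
... | tri> _ _ k<j = contradiction (P-mono-< k<j) (ℤ.<-irrefl (sym eq))

P-identity : ∀ n → let a = P (3 ℕ.+ 2 ℕ.* n); b = P (2 ℕ.+ 2 ℕ.* n) in
  (ι a + ι 1ℤ) ^ 5 + (ι a - ι 1ℤ) ^ 5 ≡ (ι a + i * (ι a + ι b)) ^ 5 + (ι a - i * (ι a + ι b)) ^ 5
-- `ι a + ι b` and `ι (a ℤ.+ b)` agree by computation.
P-identity n = pellEquation-fifth-powers (a ℤ.+ b) a (P-pellEquation n)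
  where
  a b : ℤ
  a = P (3 ℕ.+ 2 ℕ.* n)
  b = P (2 ℕ.+ 2 ℕ.* n)

pellQuadruple-isSolution : ∀ n → IsSolution (pellQuadruple n)
-- As -1 < 1 gives a - 1 < a + 1, positivity of a - 1 settles both bounds.
pellQuadruple-isSolution n = ℤ.<-trans 0<a-1 (ℤ.+-monoʳ-< (P (3 ℕ.+ 2 ℕ.* n)) ℤ.-<+) , 0<a-1 , P-identity n
  where
  0<a-1 : 0ℤ ℤ.< P (3 ℕ.+ 2 ℕ.* n) ℤ.- 1ℤ
  -- The explicit index 1 stands for `P 2`, which is 1, so the left side evaluates to 0 after the
  -- subtraction.
  0<a-1 = ℤ.+-monoˡ-< (ℤ.- 1ℤ) (P-mono-< {1} {2 ℕ.+ 2 ℕ.* n} (s≤s (s≤s z≤n)))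

-- This is what makes the family of solutions infinite. The first component a + 1 alone determines
-- the index, since the Pell numbers strictly increase.
pellQuadruple-injective : Injective _≡_ _≡_ pellQuadruple
pellQuadruple-injective {m} {n} eq =
  ℕ.*-cancelˡ-≡ m n 2 (ℕ.+-cancelˡ-≡ 2 _ _ (P-injective (∙-cancelʳ 1ℤ _ _ (cong proj₁ eq))))

theorem2p1 :
  (∀ (n : ℕ) →
    let a = P (3 ℕ.+ 2 ℕ.* n)
        b = P (2 ℕ.+ 2 ℕ.* n) in
    (ι a + ι 1ℤ) ^ 5 + (ι a - ι 1ℤ) ^ 5
      ≡ (ι a + i * (ι a + ι b)) ^ 5 + (ι a - i * (ι a + ι b)) ^ 5)
  × (∀ (n : ℕ) → IsSolution (pellQuadruple n))
  × Injective _≡_ _≡_ pellQuadruple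
  × (pellQuadruple 0 ≡ (+ 3 , + 1 , ι (+ 2) + i * ι (+ 3) , ι (+ 2) - i * ι (+ 3))
    × ι (+ 3) ^ 5 + ι (+ 1) ^ 5 ≡ (ι (+ 2) + i * ι (+ 3)) ^ 5 + (ι (+ 2) - i * ι (+ 3)) ^ 5)
  × (pellQuadruple 1 ≡ (+ 13 , + 11 , ι (+ 12) + i * ι (+ 17) , ι (+ 12) - i * ι (+ 17))
    × ι (+ 13) ^ 5 + ι (+ 11) ^ 5 ≡ (ι (+ 12) + i * ι (+ 17)) ^ 5 + (ι (+ 12) - i * ι (+ 17)) ^ 5)
  × (pellQuadruple 2 ≡ (+ 71 , + 69 , ι (+ 70) + i * ι (+ 99) , ι (+ 70) - i * ι (+ 99))
    × ι (+ 71) ^ 5 + ι (+ 69) ^ 5 ≡ (ι (+ 70) + i * ι (+ 99)) ^ 5 + (ι (+ 70) - i * ι (+ 99)) ^ 5)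
  × (pellQuadruple 3 ≡ (+ 409 , + 407 , ι (+ 408) + i * ι (+ 577) , ι (+ 408) - i * ι (+ 577))
    × ι (+ 409) ^ 5 + ι (+ 407) ^ 5 ≡ (ι (+ 408) + i * ι (+ 577)) ^ 5 + (ι (+ 408) - i * ι (+ 577)) ^ 5)
  × (pellQuadruple 4 ≡ (+ 2379 , + 2377 , ι (+ 2378) + i * ι (+ 3363) , ι (+ 2378) - i * ι (+ 3363))
    × ι (+ 2379) ^ 5 + ι (+ 2377) ^ 5 ≡ (ι (+ 2378) + i * ι (+ 3363)) ^ 5 + (ι (+ 2378) - i * ι (+ 3363)) ^ 5)
theorem2p1 =
  P-identity , pellQuadruple-isSolution , pellQuadruple-injective ,
  (refl , refl) , (refl , refl) , (refl , refl) , (refl , refl) , (refl , refl)
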